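{- Let $G$ be a finite projective plane with point set $\{x_1,\dots,x_p\}$ and with set of lines $L(G)$, and let $T:\{x_1,\dots,x_p\}\to L(G)$ be a bijection such that (1) for each point $x$ the point $x$ and the line $T(x)$ are not incident, and (2) for each pair $x\neq x'$ of points the points $x$, $x'$ and $T(x)\cap T(x')$ are not collinear. Put $y_i=T(x_i)$, and let $K$ be the set of all triples $(x_i,x_j,x_k)$ of points of $G$ such that $x_i\in y_k$, $x_j\in y_i$ and $x_j\in y_k$. Let $G_1,G_2,G_3$ be pairwise disjoint projective planes with isomorphisms $J^1:G\to G_1$, $J^2:G\to G_2$ and $J^3:G'\to G_3$, where $G'$ is the dual plane of $G$. For $t=1,2$ set $x_i^t=J^t(x_i)$ and $y_i^t=J^t(y_i)$, and set $x_i^3=J^3(y_i)$ and $y_i^3=J^3(x_i)$. Let $P_t$ and $L_t$ be the sets of points and of lines of $G_t$, let $P=P_1\cup P_2\cup P_3$, $L=L_1\cup L_2\cup L_3$, and let $\lambda:P\to L$ be the bijection $\lambda(x_i^t)=y_i^{t+1}$ ($t+1$ taken modulo $3$). Let $\mathcal{T}\subset P\times P\times P$ be the set of all triples $(x_i^1,x_j^2,x_k^3)$ with $(x_i,x_j,x_k)\in K$ together with all cyclic permutations of such triples. Then $\mathcal{T}$ is a polygonal presentation over $P$ compatible with $\lambda$.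
   Context: The notation $x\in y$ means that the point $x$ is incident to the line $y$. The dual plane $G'$ of $G$ has the lines of $G$ as its points and the points of $G$ as its lines, with the same incidence. A projective plane is identified with its bipartite incidence graph (points are the black vertices, lines are the white vertices). Polygonal presentation: let $G_1,\dots,G_n$ be disjoint connected bipartite graphs, let $P_i$ and $L_i$ be the sets of black and white vertices of $G_i$, let $P=\bigcup P_i$, $L=\bigcup L_i$, and let $\lambda:P\to L$ be a bijection. A set $\mathcal{K}$ of $k$-tuples $(x_1,\dots,x_k)$ with $x_i\in P$ is a polygonal presentation over $P$ compatible with $\lambda$ if: (1) $(x_1,x_2,\dots,x_k)\in\mathcal{K}$ implies $(x_2,\dots,x_k,x_1)\in\mathcal{K}$; (2) given $x_1,x_2\in P$, one has $(x_1,x_2,x_3,\dots,x_k)\in\mathcal{K}$ for some $x_3,\dots,x_k$ if and only if $x_2$ and $\lambda(x_1)$ are incident in some $G_i$; (3) given $x_1,x_2\in P$, one has $(x_1,x_2,x_3,\dots,x_k)\in\mathcal{K}$ for at most one $x_3\in P$. -}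

module Defs where

open import Data.Fin using (Fin)
open import Data.Fin.Patterns using (0F; 1F; 2F)
open import Data.Nat using (ℕ; _+_)
open import Data.Product using (Σ; ∃; ∃!; ∃-syntax; _×_; _,_; proj₁)
open import Data.Sum using (_⊎_; inj₁; inj₂)
open import Data.Vec using (Vec; []; _∷_; _∷ʳ_)
open import Function using (_∘_; flip)
open import Function.Bundles using (_↔_; _⤖_; _⇔_; Inverse)
open import Function.Construct.Composition using (_↔-∘_)
open import Function.Properties.Bijection using (⤖⇒↔)
open import Function.Definitions using (Bijective)
open import Relation.Binary.Construct.Closure.Equivalence using (EqClosure)
open import Relation.Binary.PropositionalEquality using (_≡_; _≢_)
open import Relation.Nullary using (¬_)
open import Relation.Unary using (Pred)
open import Level using (0ℓ)

record BipartiteGraph : Set₁ where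
  field
    Black : Set
    White : Set
    Adj   : Black → White → Set

  Vertex : Set
  Vertex = Black ⊎ White

  data Edge : Vertex → Vertex → Set where
    edge : ∀ {b w} → Adj b w → Edge (inj₁ b) (inj₂ w)

  -- EqClosure Edge u v is the type of walks from u to v, each step
  -- traversing an edge in either direction.
  Connected : Set
  Connected = ∀ u v → EqClosure Edge u v

open BipartiteGraph using (Black; White; Adj; Connected)

dual : BipartiteGraph → BipartiteGraph
dual G = record { Black = White G ; White = Black G ; Adj = flip (Adj G) }

record _≅_ (G H : BipartiteGraph) : Set where
  field
    points   : Black G ↔ Black H
    lines    : White G ↔ White H
    incident : ∀ a l → Adj G a l ⇔ Adj H (Inverse.to points a) (Inverse.to lines l)

record ProjectivePlane : Set₁ where
  infix 4 _∈_
  field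
    Point : Set
    Line  : Set
    _∈_   : Point → Line → Set

  -- The incidence graph, with which a plane is identified.
  graph : BipartiteGraph
  graph = record { Black = Point ; White = Line ; Adj = _∈_ }

  Collinear : Point → Point → Point → Set
  Collinear a b c = ∃[ l ] (a ∈ l × b ∈ l × c ∈ l)

  field
    join-∃! : ∀ {a b : Point} → a ≢ b → ∃! _≡_ (λ l → a ∈ l × b ∈ l)
    meet-∃! : ∀ {l m : Line} → l ≢ m → ∃! _≡_ (λ a → a ∈ l × a ∈ m)
    quadrangle : ∃[ a ] ∃[ b ] ∃[ c ] ∃[ d ]
      (a ≢ b × a ≢ c × a ≢ d × b ≢ c × b ≢ d × c ≢ d ×
       ¬ Collinear a b c × ¬ Collinear a b d ×
       ¬ Collinear a c d × ¬ Collinear b c d)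

  meet : ∀ {l m : Line} → l ≢ m → Point
  meet l≢m = proj₁ (meet-∃! l≢m)

open ProjectivePlane using (graph; Point; Line)

-- The graphs of a family are made disjoint by tagging each vertex with the
-- index of its graph.
module _ {n : ℕ} (G : Fin n → BipartiteGraph) where

  ⋃Black ⋃White : Set
  ⋃Black = Σ (Fin n) (Black ∘ G)
  ⋃White = Σ (Fin n) (White ∘ G)

  data IncidentInSome : ⋃Black → ⋃White → Set where
    incidentIn : ∀ i {b w} → Adj (G i) b w → IncidentInSome (i , b) (i , w)

  -- The tuples have length k = 3 + m: the definition speaks of x₁, x₂, x₃.
  -- The standing assumptions that the graphs are connected and that lam is a
  -- bijection are part of what has to be verified.
  record IsPolygonalPresentation {m : ℕ} (lam : ⋃Black → ⋃White)
                                 (𝒦 : Pred (Vec ⋃Black (3 + m)) 0ℓ) : Set where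
    field
      connected     : ∀ i → Connected (G i)
      lam-bijective : Bijective _≡_ _≡_ lam
      cyclic        : ∀ x xs → 𝒦 (x ∷ xs) → 𝒦 (xs ∷ʳ x)
      extends       : ∀ x₁ x₂ →
                      (∃[ xs ] 𝒦 (x₁ ∷ x₂ ∷ xs)) ⇔ IncidentInSome x₂ (lam x₁)
      unique        : ∀ x₁ x₂ x₃ x₃′ xs xs′ →
                      𝒦 (x₁ ∷ x₂ ∷ x₃ ∷ xs) → 𝒦 (x₁ ∷ x₂ ∷ x₃′ ∷ xs′) → x₃ ≡ x₃′

-- The indices 1, 2, 3 of the three planes are 0F, 1F, 2F.
module Triangle
  (G : ProjectivePlane) {p : ℕ} (x : Fin p ↔ Point G) (T : Point G ⤖ Line G)
  (Gₜ : Fin 3 → ProjectivePlane)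
  (J¹ : graph G ≅ graph (Gₜ 0F))
  (J² : graph G ≅ graph (Gₜ 1F))
  (J³ : dual (graph G) ≅ graph (Gₜ 2F))
  where

  open ProjectivePlane G using (_∈_)
  open _≅_

  y : Fin p ↔ Line G
  y = ⤖⇒↔ T ↔-∘ x

  -- Points are given by their indices in the enumeration x.
  K : Fin p → Fin p → Fin p → Set
  K i j k = x.to i ∈ y.to k × x.to j ∈ y.to i × x.to j ∈ y.to k
    where
    module x = Inverse x
    module y = Inverse y

  xᵗ : ∀ t → Fin p ↔ Point (Gₜ t)
  xᵗ 0F = points J¹ ↔-∘ x
  xᵗ 1F = points J² ↔-∘ x
  xᵗ 2F = points J³ ↔-∘ y

  yᵗ : ∀ t → Fin p ↔ Line (Gₜ t)
  yᵗ 0F = lines J¹ ↔-∘ y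
  yᵗ 1F = lines J² ↔-∘ y
  yᵗ 2F = lines J³ ↔-∘ x

  next : Fin 3 → Fin 3
  next 0F = 1F
  next 1F = 2F
  next 2F = 0F

  P L : Set
  P = ⋃Black (graph ∘ Gₜ)
  L = ⋃White (graph ∘ Gₜ)

  -- Sends xᵢᵗ to yᵢᵗ⁺¹; the index i is recovered from a point of Gₜ by
  -- inverting the enumeration xᵗ.
  lam : P → L
  lam (t , a) = next t , Inverse.to (yᵗ (next t)) (Inverse.from (xᵗ t) a)

  pt : Fin 3 → Fin p → P
  pt t i = t , Inverse.to (xᵗ t) i

  𝒯 : Pred (Vec P 3) 0ℓ
  𝒯 v = ∃[ i ] ∃[ j ] ∃[ k ] (K i j k ×
      (  v ≡ pt 0F i ∷ pt 1F j ∷ pt 2F k ∷ []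
       ⊎ v ≡ pt 1F j ∷ pt 2F k ∷ pt 0F i ∷ []
       ⊎ v ≡ pt 2F k ∷ pt 0F i ∷ pt 1F j ∷ []))

{-# OPTIONS --safe #-}

-- Three pairs of indices (i , j), (j , k), (k , i) have to extend uniquely to a
-- triple of K.  A pair (i , j) determines y_k as the join of x_i and x_j, and a
-- pair (k , i) determines x_j as the meet of y_k and y_i.  A pair (j , k) asks
-- for a point x_i of l = y_k such that y_i passes through the given point x_j of
-- l: by condition (2) the map x ↦ T(x) ∩ l is injective on the points of l, so
-- by finiteness it permutes them.

module Submission where

open import Defs
open import Data.Fin using (Fin; punchOut; _≟_)
open import Data.Fin.Patterns using (0F; 1F; 2F)
open import Data.Fin.Properties using (any?; inj⇒≟; injective⇒≤; punchOut-injective)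
open import Data.Nat using (ℕ)
open import Data.Nat.Properties using (1+n≰n)
open import Data.Product using (∃; ∃-syntax; _×_; _,_; proj₁; proj₂)
open import Data.Sum using (inj₁; inj₂)
open import Data.Vec using (Vec; []; _∷_; _∷ʳ_; head; tail)
open import Function using (_∘_)
open import Function.Bundles using (_↔_; _⤖_; _⇔_; Bijection; Equivalence; Inverse; mk⇔; mk↔ₛ′)
open import Function.Definitions using (Bijective; Injective; StrictlySurjective)
open import Function.Properties.Inverse using (↔-sym; ↔⇒↣; ↔⇒⤖)
open import Relation.Binary.Construct.Closure.Equivalence using (EqClosure; symmetric)
open import Relation.Binary.Construct.Closure.ReflexiveTransitive using (ε; _◅_; _◅◅_)
open import Relation.Binary.Construct.Closure.Symmetric using (fwd; bwd)
open import Relation.Binary.Definitions using (Decidable; DecidableEquality)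
open import Relation.Binary.PropositionalEquality
  using (_≡_; _≢_; refl; sym; trans; cong; subst; subst₂)
open import Relation.Nullary using (¬_; yes; no; contradiction)
open import Relation.Nullary.Decidable using (decidable-stable)

-- Injective self-maps of finite sets

-- If `i` were missed, punching it out of the codomain would leave an injection into a set with one
-- element fewer.
Fin-injective⇒strictlySurjective : ∀ {n} {f : Fin n → Fin n} →
  Injective _≡_ _≡_ f → StrictlySurjective _≡_ f
Fin-injective⇒strictlySurjective {ℕ.suc n} {f} f-inj i with any? (λ j → f j ≟ i)
... | yes hit  = hit
... | no  miss = contradiction (injective⇒≤ punched-injective) 1+n≰n
  where
  i≢f : ∀ j → i ≢ f j
  i≢f j i≡fj = miss (j , sym i≡fj)

  punched-injective : Injective _≡_ _≡_ (λ j → punchOut (i≢f j))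
  punched-injective = f-inj ∘ punchOut-injective (i≢f _) (i≢f _)

↔-injective : ∀ {A B : Set} (e : A ↔ B) → Injective _≡_ _≡_ (Inverse.to e)
↔-injective e = Bijection.injective (↔⇒⤖ e)

injective⇒strictlySurjective : ∀ {A : Set} {n} → Fin n ↔ A → {f : A → A} →
  Injective _≡_ _≡_ f → StrictlySurjective _≡_ f
injective⇒strictlySurjective x {f} f-inj a = to (proj₁ hit) , from-injective (proj₂ hit)
  where
  open Inverse x using (to; from)

  from-injective : Injective _≡_ _≡_ from
  from-injective = ↔-injective (↔-sym x)

  hit = Fin-injective⇒strictlySurjective {f = from ∘ f ∘ to}
          (↔-injective x ∘ f-inj ∘ from-injective) (from a)

↔Fin⇒≟ : ∀ {A : Set} {n} → Fin n ↔ A → DecidableEquality A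
↔Fin⇒≟ x = inj⇒≟ (↔⇒↣ (↔-sym x))

-- Joins, meets, decidable incidence and connectedness in a plane

module Plane (G : ProjectivePlane) where
  open ProjectivePlane G

  join : ∀ {a b} → a ≢ b → Line
  join a≢b = proj₁ (join-∃! a≢b)

  join-∋ˡ : ∀ {a b} (a≢b : a ≢ b) → a ∈ join a≢b
  join-∋ˡ a≢b = proj₁ (proj₁ (proj₂ (join-∃! a≢b)))

  join-∋ʳ : ∀ {a b} (a≢b : a ≢ b) → b ∈ join a≢b
  join-∋ʳ a≢b = proj₂ (proj₁ (proj₂ (join-∃! a≢b)))

  join-unique : ∀ {a b l} (a≢b : a ≢ b) → a ∈ l → b ∈ l → join a≢b ≡ l
  join-unique a≢b a∈l b∈l = proj₂ (proj₂ (join-∃! a≢b)) (a∈l , b∈l)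

  meet-∈ˡ : ∀ {l m} (l≢m : l ≢ m) → meet l≢m ∈ l
  meet-∈ˡ l≢m = proj₁ (proj₁ (proj₂ (meet-∃! l≢m)))

  meet-∈ʳ : ∀ {l m} (l≢m : l ≢ m) → meet l≢m ∈ m
  meet-∈ʳ l≢m = proj₂ (proj₁ (proj₂ (meet-∃! l≢m)))

  meet-unique : ∀ {l m a} (l≢m : l ≢ m) → a ∈ l → a ∈ m → meet l≢m ≡ a
  meet-unique l≢m a∈l a∈m = proj₂ (proj₂ (meet-∃! l≢m)) (a∈l , a∈m)

  module Finite {p} (x : Fin p ↔ Point) (y : Fin p ↔ Line) where

    _≟ₚ_ : DecidableEquality Point
    _≟ₚ_ = ↔Fin⇒≟ x

    _≟ₗ_ : DecidableEquality Line
    _≟ₗ_ = ↔Fin⇒≟ y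

    -- The line through two points of the quadrangle serves as a reference: `l` either equals it or
    -- meets it.
    pointOn : ∀ l → ∃ (_∈ l)
    pointOn l with a , b , c , d , a≢b , _ ← quadrangle with l ≟ₗ join a≢b
    ... | yes refl = a , join-∋ˡ a≢b
    ... | no  l≢ab = meet l≢ab , meet-∈ˡ l≢ab

    -- Reduces incidence to equality of lines: a point `a` other than a known point `u` of `l` lies
    -- on `l` exactly when the line `au` is `l`.
    _∈?_ : Decidable _∈_
    a ∈? l with u , u∈l ← pointOn l with a ≟ₚ u
    ... | yes refl = yes u∈l
    ... | no  a≢u with join a≢u ≟ₗ l
    ...   | yes refl = yes (join-∋ˡ a≢u)
    ...   | no  au≢l = no λ a∈l → au≢l (join-unique a≢u a∈l u∈l)

    connected : BipartiteGraph.Connected graph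
    connected = walk
      where
      open BipartiteGraph graph using (Vertex; Edge; edge)

      Walk : Vertex → Vertex → Set
      Walk = EqClosure Edge

      incident : ∀ {a l} → a ∈ l → Walk (inj₁ a) (inj₂ l)
      incident a∈l = fwd (edge a∈l) ◅ ε

      points : ∀ a b → Walk (inj₁ a) (inj₁ b)
      points a b with a ≟ₚ b
      ... | yes refl = ε
      ... | no  a≢b  = incident (join-∋ˡ a≢b) ◅◅ symmetric Edge (incident (join-∋ʳ a≢b))

      point-line : ∀ a l → Walk (inj₁ a) (inj₂ l)
      point-line a l with u , u∈l ← pointOn l = points a u ◅◅ incident u∈l

      walk : ∀ u v → Walk u v
      walk (inj₁ a) (inj₁ b) = points a b
      walk (inj₁ a) (inj₂ l) = point-line a l
      walk (inj₂ l) (inj₁ a) = symmetric Edge (point-line a l)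
      walk (inj₂ l) (inj₂ m) with u , u∈l ← pointOn l =
        symmetric Edge (incident u∈l) ◅◅ point-line u m

  -- The permutation that `T` induces on the points of a line

  module Twisted
    {p : ℕ} (x : Fin p ↔ Point) (y : Fin p ↔ Line)
    (T : Point → Line) (T-injective : Injective _≡_ _≡_ T)
    (a∉Ta : ∀ a → ¬ (a ∈ T a))
    (noncollinear : ∀ a b (a≢b : a ≢ b) → ¬ Collinear a b (meet (a≢b ∘ T-injective)))
    where

    open Finite x y

    ∉-∈⇒≢ : ∀ {a l m} → ¬ (a ∈ l) → a ∈ m → l ≢ m
    ∉-∈⇒≢ a∉l a∈m refl = a∉l a∈m

    ∈T⇒≢ : ∀ {a b} → b ∈ T a → a ≢ b
    ∈T⇒≢ b∈Ta refl = a∉Ta _ b∈Ta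

    -- For `a ≢ b` the point `c` would be the meet of `T a` and `T b`, and condition (2) keeps that
    -- meet off every line through `a` and `b`.
    same-trace⇒≡ : ∀ {a b c l} → a ∈ l → b ∈ l → c ∈ l → c ∈ T a → c ∈ T b → a ≡ b
    same-trace⇒≡ {a} {b} {c} {l} a∈l b∈l c∈l c∈Ta c∈Tb =
      decidable-stable (a ≟ₚ b) λ a≢b → noncollinear a b a≢b
        (l , a∈l , b∈l , subst (_∈ l) (sym (meet-unique _ c∈Ta c∈Tb)) c∈l)

    module _ (l : Line) where

      -- Extended by the identity outside l, so that finiteness of the set of all
      -- points applies.
      trace : Point → Point
      trace a with a ∈? l
      ... | yes a∈l = meet (∉-∈⇒≢ (a∉Ta a) a∈l)
      ... | no  _   = a

      -- Points of `l` stay on `l` and all others are fixed, so a collision can only involve two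
      -- points of the same kind.
      trace-injective : Injective _≡_ _≡_ trace
      trace-injective {a} {b} eq with a ∈? l | b ∈? l
      ... | no  _   | no  _   = eq
      ... | no  a∉l | yes b∈l = contradiction (subst (_∈ l) (sym eq) (meet-∈ʳ _)) a∉l
      ... | yes a∈l | no  b∉l = contradiction (subst (_∈ l) eq (meet-∈ʳ _)) b∉l
      ... | yes a∈l | yes b∈l = same-trace⇒≡ a∈l b∈l (meet-∈ʳ _) (meet-∈ˡ _)
                                  (subst (_∈ T b) (sym eq) (meet-∈ˡ _))

      trace-surjective : ∀ {c} → c ∈ l → ∃[ a ] (a ∈ l × c ∈ T a)
      trace-surjective {c} c∈l
        with a , eq ← injective⇒strictlySurjective x trace-injective c
        with a ∈? l
      ... | yes a∈l = a , a∈l , subst (_∈ T a) eq (meet-∈ˡ _)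
      -- A preimage off `l` is fixed, so it would be `c` itself.
      ... | no  a∉l = contradiction (subst (_∈ l) (sym eq) c∈l) a∉l

-- The polygonal presentation

module _ (G : ProjectivePlane) where
  open ProjectivePlane G
  open Plane G

  module Presentation
    {p : ℕ} (x : Fin p ↔ Point) (T : Point ⤖ Line)
    (a∉Ta : ∀ a → ¬ (a ∈ Bijection.to T a))
    (noncollinear : ∀ a b (a≢b : a ≢ b) → ¬ Collinear a b (meet (a≢b ∘ Bijection.injective T)))
    (Gₜ : Fin 3 → ProjectivePlane)
    (J¹ : graph ≅ ProjectivePlane.graph (Gₜ 0F))
    (J² : graph ≅ ProjectivePlane.graph (Gₜ 1F))
    (J³ : dual graph ≅ ProjectivePlane.graph (Gₜ 2F))
    where

    open Triangle G x T Gₜ J¹ J² J³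
    open Twisted x y (Bijection.to T) (Bijection.injective T) a∉Ta noncollinear

    private
      module x  = Inverse x
      module y  = Inverse y
      module xᵗ t = Inverse (xᵗ t)
      module yᵗ t = Inverse (yᵗ t)

    -- Inc t i j says that x_j^{t+1} is incident to λ(x_i^t) = y_i^{t+1}, read in G;
    -- with it K i j k is Inc 0F i j × Inc 1F j k × Inc 2F k i up to reordering.
    Inc : Fin 3 → Fin p → Fin p → Set
    Inc 0F i j = x.to j ∈ y.to i
    Inc 1F j k = x.to j ∈ y.to k
    Inc 2F k i = x.to i ∈ y.to k

    -- At `1F` the target plane is the dual one, where the point and the line stand for `y_k` and
    -- `x_j`; hence the reversed roles in `Inc 1F`.
    Inc⇔incident : ∀ t i j →
      Inc t i j ⇔ ProjectivePlane._∈_ (Gₜ (next t)) (xᵗ.to (next t) j) (yᵗ.to (next t) i)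
    Inc⇔incident 0F i j = _≅_.incident J² _ _
    Inc⇔incident 1F j k = _≅_.incident J³ _ _
    Inc⇔incident 2F k i = _≅_.incident J¹ _ _

    -- Rotated so that the first index belongs to plane `t`; the three cyclic forms of a triple can
    -- then be handled uniformly in `t`.
    Kᵗ : Fin 3 → Fin p → Fin p → Fin p → Set
    Kᵗ 0F i j k = K i j k
    Kᵗ 1F j k i = K i j k
    Kᵗ 2F k i j = K i j k

    triple : Fin 3 → Fin p → Fin p → Fin p → Vec P 3
    triple t a b c = pt t a ∷ pt (next t) b ∷ pt (next (next t)) c ∷ []

    Kᵗ⇒𝒯 : ∀ t {a b c} → Kᵗ t a b c → 𝒯 (triple t a b c)
    Kᵗ⇒𝒯 0F κ = _ , _ , _ , κ , inj₁ refl
    Kᵗ⇒𝒯 1F κ = _ , _ , _ , κ , inj₂ (inj₁ refl)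
    Kᵗ⇒𝒯 2F κ = _ , _ , _ , κ , inj₂ (inj₂ refl)

    𝒯⇒Kᵗ : ∀ {v} → 𝒯 v → ∃[ t ] ∃[ a ] ∃[ b ] ∃[ c ] (Kᵗ t a b c × v ≡ triple t a b c)
    𝒯⇒Kᵗ (_ , _ , _ , κ , inj₁ eq)        = 0F , _ , _ , _ , κ , eq
    𝒯⇒Kᵗ (_ , _ , _ , κ , inj₂ (inj₁ eq)) = 1F , _ , _ , _ , κ , eq
    𝒯⇒Kᵗ (_ , _ , _ , κ , inj₂ (inj₂ eq)) = 2F , _ , _ , _ , κ , eq

    Kᵗ⇒Inc : ∀ t {a b c} → Kᵗ t a b c → Inc t a b
    Kᵗ⇒Inc 0F (i∈k , j∈i , j∈k) = j∈i
    Kᵗ⇒Inc 1F (i∈k , j∈i , j∈k) = j∈k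
    Kᵗ⇒Inc 2F (i∈k , j∈i , j∈k) = i∈k

    -- Condition (1) makes the join and the meet available: `x_j` on `y_i` forces `x_i ≢ x_j`, and
    -- `x_i` on `y_k` forces `y_i ≢ y_k`. The middle case is surjectivity of the trace on `y_k`.
    Inc⇒Kᵗ : ∀ t {a b} → Inc t a b → ∃[ c ] Kᵗ t a b c
    Inc⇒Kᵗ 0F j∈i =
      y.from ij , subst (_ ∈_) (sym eq) (join-∋ˡ i≢j) , j∈i , subst (_ ∈_) (sym eq) (join-∋ʳ i≢j)
      where
      i≢j = ∈T⇒≢ j∈i
      ij  = join i≢j
      eq  = y.strictlyInverseˡ ij
    Inc⇒Kᵗ 1F {j} {k} j∈k with a , a∈k , j∈Ta ← trace-surjective (y.to k) j∈k =
      x.from a , subst (_∈ y.to k) (sym eq) a∈k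
               , subst (λ a → x.to j ∈ Bijection.to T a) (sym eq) j∈Ta , j∈k
      where eq = x.strictlyInverseˡ a
    Inc⇒Kᵗ 2F i∈k =
      x.from ik , i∈k , subst (_∈ _) (sym eq) (meet-∈ˡ i≢k) , subst (_∈ _) (sym eq) (meet-∈ʳ i≢k)
      where
      i≢k = ∉-∈⇒≢ (a∉Ta _) i∈k
      ik  = meet i≢k
      eq  = x.strictlyInverseˡ ik

    Kᵗ-unique : ∀ t {a b c c′} → Kᵗ t a b c → Kᵗ t a b c′ → c ≡ c′
    Kᵗ-unique 0F (i∈k , j∈i , j∈k) (i∈k′ , _ , j∈k′) = ↔-injective y
      (trans (sym (join-unique i≢j i∈k j∈k)) (join-unique i≢j i∈k′ j∈k′))
      where i≢j = ∈T⇒≢ j∈i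
    Kᵗ-unique 1F (i∈k , j∈i , j∈k) (i′∈k , j∈i′ , _) =
      ↔-injective x (same-trace⇒≡ i∈k i′∈k j∈k j∈i j∈i′)
    Kᵗ-unique 2F (i∈k , j∈i , j∈k) (_ , j′∈i , j′∈k) = ↔-injective x
      (trans (sym (meet-unique i≢k j∈i j∈k)) (meet-unique i≢k j′∈i j′∈k))
      where i≢k = ∉-∈⇒≢ (a∉Ta _) i∈k

    -- A left inverse of `pt` into a plain product, which avoids comparing second components of
    -- different types.
    index : P → Fin 3 × Fin p
    index (t , a) = t , xᵗ.from t a

    pt-injective : ∀ {t a s b} → pt t a ≡ pt s b → (t , a) ≡ (s , b)
    pt-injective {t} {a} {s} {b} eq =
      trans (cong (t ,_) (sym (xᵗ.strictlyInverseʳ t a)))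
        (trans (cong index eq) (cong (s ,_) (xᵗ.strictlyInverseʳ s b)))

    pt-index : ∀ t a → pt t (xᵗ.from t a) ≡ (t , a)
    pt-index t a = cong (t ,_) (xᵗ.strictlyInverseˡ t a)

    lam-pt : ∀ t i → lam (pt t i) ≡ (next t , yᵗ.to (next t) i)
    lam-pt t i = cong (λ j → next t , yᵗ.to (next t) j) (xᵗ.strictlyInverseʳ t i)

    lam-bijective : Bijective _≡_ _≡_ lam
    lam-bijective = Bijection.bijective (↔⇒⤖ (mk↔ₛ′ lam lam⁻¹ lam-lam⁻¹ lam⁻¹-lam))
      where
      lam⁻¹ : L → P
      lam⁻¹ (0F , l) = pt 2F (yᵗ.from 0F l)
      lam⁻¹ (1F , l) = pt 0F (yᵗ.from 1F l)
      lam⁻¹ (2F , l) = pt 1F (yᵗ.from 2F l)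

      lam-lam⁻¹ : ∀ l → lam (lam⁻¹ l) ≡ l
      lam-lam⁻¹ (0F , l) = trans (lam-pt 2F _) (cong (0F ,_) (yᵗ.strictlyInverseˡ 0F l))
      lam-lam⁻¹ (1F , l) = trans (lam-pt 0F _) (cong (1F ,_) (yᵗ.strictlyInverseˡ 1F l))
      lam-lam⁻¹ (2F , l) = trans (lam-pt 1F _) (cong (2F ,_) (yᵗ.strictlyInverseˡ 2F l))

      lam⁻¹-lam : ∀ a → lam⁻¹ (lam a) ≡ a
      lam⁻¹-lam (0F , a) = trans (cong (pt 0F) (yᵗ.strictlyInverseʳ 1F _)) (pt-index 0F a)
      lam⁻¹-lam (1F , a) = trans (cong (pt 1F) (yᵗ.strictlyInverseʳ 2F _)) (pt-index 1F a)
      lam⁻¹-lam (2F , a) = trans (cong (pt 2F) (yᵗ.strictlyInverseʳ 0F _)) (pt-index 2F a)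

    cyclic : ∀ u us → 𝒯 (u ∷ us) → 𝒯 (us ∷ʳ u)
    cyclic _ _ (i , j , k , κ , inj₁ refl)        = i , j , k , κ , inj₂ (inj₁ refl)
    cyclic _ _ (i , j , k , κ , inj₂ (inj₁ refl)) = i , j , k , κ , inj₂ (inj₂ refl)
    cyclic _ _ (i , j , k , κ , inj₂ (inj₂ refl)) = i , j , k , κ , inj₁ refl

    Incident : P → L → Set
    Incident = IncidentInSome (ProjectivePlane.graph ∘ Gₜ)

    𝒯⇒incident : ∀ {u v vs} → 𝒯 (u ∷ v ∷ vs) → Incident v (lam u)
    𝒯⇒incident τ with t , a , b , c , κ , refl ← 𝒯⇒Kᵗ τ =
      subst (Incident _) (sym (lam-pt t a))
        (incidentIn (next t) (Equivalence.to (Inc⇔incident t a b) (Kᵗ⇒Inc t κ)))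

    incident⇒𝒯 : ∀ u v → Incident v (lam u) → ∃[ vs ] 𝒯 (u ∷ v ∷ vs)
    incident⇒𝒯 (t , u) _ (incidentIn _ {v} v∈λu)
      with c , κ ← Inc⇒Kᵗ t {xᵗ.from t u} {xᵗ.from (next t) v}
                     (Equivalence.from (Inc⇔incident t _ _)
                       -- Only `v` needs rewriting, since `lam` already expresses its value through
                       -- the index of `u`.
                       (subst (λ v → ProjectivePlane._∈_ (Gₜ (next t)) v _)
                         (sym (xᵗ.strictlyInverseˡ (next t) v)) v∈λu))
      = _ , subst₂ (λ u v → 𝒯 (u ∷ v ∷ pt (next (next t)) c ∷ []))
              (pt-index t u) (pt-index (next t) v) (Kᵗ⇒𝒯 t κ)

    unique : ∀ u v w w′ ws ws′ → 𝒯 (u ∷ v ∷ w ∷ ws) → 𝒯 (u ∷ v ∷ w′ ∷ ws′) → w ≡ w′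
    unique u v w w′ ws ws′ τ τ′
      with t , a , b , c , κ , refl ← 𝒯⇒Kᵗ τ
         | t′ , a′ , b′ , c′ , κ′ , eq ← 𝒯⇒Kᵗ τ′
      -- The tag of the first entry fixes the rotation, so both triples have the same `t` and the
      -- same first index.
      with refl ← pt-injective (cong head eq)
      with refl ← cong proj₂ (pt-injective (cong (head ∘ tail) eq))
      = trans (cong (pt (next (next t))) (Kᵗ-unique t κ κ′)) (sym (cong (head ∘ tail ∘ tail) eq))

    isPolygonalPresentation : IsPolygonalPresentation (ProjectivePlane.graph ∘ Gₜ) lam 𝒯
    isPolygonalPresentation = record
      -- The enumerations `xᵗ t` and `yᵗ t` make each plane finite, which gives the decidable
      -- equalities behind the walks.
      { connected     = λ t → Plane.Finite.connected (Gₜ t) (xᵗ t) (yᵗ t)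
      ; lam-bijective = lam-bijective
      ; cyclic        = cyclic
      ; extends       = λ u v → mk⇔ (𝒯⇒incident ∘ proj₂) (incident⇒𝒯 u v)
      ; unique        = unique
      }

proposition2p3 : (G : ProjectivePlane) → let open ProjectivePlane G in
    (p : ℕ) (x : Fin p ↔ Point) (T : Point ⤖ Line) →
    let T[_] = Bijection.to T in
    (∀ a → ¬ (a ∈ T[ a ])) →
    (∀ a b (a≢b : a ≢ b) → ¬ Collinear a b (meet (a≢b ∘ Bijection.injective T))) →
    (Gₜ : Fin 3 → ProjectivePlane)
    (J¹ : graph ≅ ProjectivePlane.graph (Gₜ 0F))
    (J² : graph ≅ ProjectivePlane.graph (Gₜ 1F))
    (J³ : dual graph ≅ ProjectivePlane.graph (Gₜ 2F)) →
    let open Triangle G x T Gₜ J¹ J² J³ in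
    IsPolygonalPresentation (ProjectivePlane.graph ∘ Gₜ) lam 𝒯
proposition2p3 G _ x T a∉Ta noncollinear Gₜ J¹ J² J³ =
  Presentation.isPolygonalPresentation G x T a∉Ta noncollinear Gₜ J¹ J² J³
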